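{- Let $n\ge 1$, let $b=(b_1,\dots,b_n)$ be a sequence of positive integers, and let $k\ge 0$ be an integer. Let $\varphi:\mathbb{R}^{n+1}\to\mathbb{R}^n$ be the linear map $(a_1,\dots,a_{n+1})\mapsto(x_1,\dots,x_n)$ with $x_i=b_i(a_1+\cdots+a_i)$ for $i=1,\dots,n$. Then $\varphi$ restricts to a bijection $$\varphi:\Pi(b)_k\longrightarrow k\cdot P(b)\cap\mathbb{Z}^n$$ from the set of L-S paths of degree $k$ to the set of integral points in the $k$-dilated lecture hall polytope.
   Context: For $b=(b_1,\dots,b_n)$, let $e_1,\dots,e_{n+1}$ be the canonical basis of $\mathbb{R}^{n+1}$ and let $L(b)\subset\mathbb{R}^{n+1}$ be the lattice generated by $v_j:=\frac{e_j-e_{j+1}}{b_j}$ for $j=1,\dots,n$ and $v_{n+1}:=e_{n+1}$. The set of L-S paths with bonds $b$ is $\Pi(b):=L(b)\cap\mathbb{R}^{n+1}_{\ge 0}$. The degree of $\pi=(a_1,\dots,a_{n+1})\in\Pi(b)$ is $\deg(\pi):=a_1+\cdots+a_{n+1}$, which is a non-negative integer, and $\Pi(b)_k$ is the set of L-S paths of degree $k$. The lecture hall polytope with parameters $b$ is $P(b):=\{(x_1,\dots,x_n)\in\mathbb{R}^n : 0\le\frac{x_1}{b_1}\le\cdots\le\frac{x_n}{b_n}\le 1\}$; its dilation $k\cdot P(b)$ is given by the same inequalities with the rightmost $1$ replaced by $k$. -}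

module Defs where

open import Algebra.Bundles.Raw using (RawMonoid)
import Algebra.Definitions.RawMonoid as RawMonoidDefs
open import Data.Fin using (Fin; zero; suc; inject; inject₁; fromℕ; Fin′; _≟_)
open import Data.Fin.Relation.Unary.Top using (view; ‵fromℕ; ‵inject₁)
open import Data.Integer using (ℤ; +_)
open import Data.Nat as ℕ using (ℕ; suc; NonZero)
import Data.Nat.Properties as ℕ
open import Data.Product using (Σ; ∃; ∃-syntax; _×_; _,_; proj₁)
open import Data.Rational
  using (ℚ; _/_; _+_; _*_; _-_; -_; ∣_∣; 0ℚ; 1ℚ; _≤_; _<_; Positive; positive; nonNegative; 1/_; ½)
  renaming (NonZero to NonZeroℚ)
open import Data.Rational.Properties
  using ( +-inverseʳ; +-mono-<; +-monoʳ-≤; +-identityʳ; *-assoc; *-identityˡ; *-inverseʳ; *-distribʳ-+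
        ; *-monoʳ-<-pos; *-monoʳ-≤-nonNeg; ∣p+q∣≤∣p∣+∣q∣; ∣p*q∣≡∣p∣*∣q∣; 0≤∣p∣
        ; positive⁻¹; nonNegative⁻¹; nonNeg+pos⇒pos; pos*pos⇒pos; pos⇒nonZero; 1/pos⇒pos; module ≤-Reasoning )
open import Data.Rational.Solver using (module +-*-Solver)
open import Data.Vec.Functional using (Vector)
open import Data.Vec.Functional.Relation.Binary.Pointwise using (Pointwise)
open import Function using (_on_)
open import Function.Structures using (IsBijection)
open import Relation.Binary using (Rel)
open import Relation.Binary.PropositionalEquality using (_≡_; refl; sym; trans; cong; subst)
open import Relation.Nullary using (yes; no)
open import Relation.Unary using (Pred; _∩_)
open import Level using (0ℓ)

------------------------------------------------------------------------
-- ℝ as Cauchy sequences of rationals.  Equality of reals is the relation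
-- `_≈ℝ_` (the difference is a null sequence); no quotient is taken.

record ℝ : Set where
  constructor mkℝ
  field
    seq    : ℕ → ℚ
    cauchy : ∀ ε → 0ℚ < ε →
             ∃[ N ] (∀ m n → N ℕ.≤ m → N ℕ.≤ n → ∣ seq m - seq n ∣ < ε)

open ℝ public

infix  4 _≈ℝ_ _≤ℝ_
infixl 6 _+ℝ_ _-ℝ_
infixr 7 _·_
infixl 7 _÷_

_≈ℝ_ : Rel ℝ 0ℓ
x ≈ℝ y = ∀ ε → 0ℚ < ε → ∃[ N ] (∀ n → N ℕ.≤ n → ∣ seq x n - seq y n ∣ < ε)

_≤ℝ_ : Rel ℝ 0ℓ
x ≤ℝ y = ∀ ε → 0ℚ < ε → ∃[ N ] (∀ n → N ℕ.≤ n → seq x n ≤ seq y n + ε)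

fromℚ : ℚ → ℝ
fromℚ q = mkℝ (λ _ → q) λ ε 0<ε →
  0 , λ _ _ _ _ → subst (_< ε) (sym (cong ∣_∣ (+-inverseʳ q))) 0<ε

fromℤ : ℤ → ℝ
fromℤ z = fromℚ (z / 1)

0ℝ : ℝ
0ℝ = fromℚ 0ℚ

private
  half+half : ∀ ε → ½ * ε + ½ * ε ≡ ε
  half+half ε = trans (sym (*-distribʳ-+ ε ½ ½)) (*-identityˡ ε)

  0<½ε : ∀ {ε} → 0ℚ < ε → 0ℚ < ½ * ε
  0<½ε {ε} 0<ε = positive⁻¹ (½ * ε) {{pos*pos⇒pos ½ ε {{positive 0<ε}}}}

  rearrange : ∀ a b c d → (a + b) - (c + d) ≡ (a - c) + (b - d)
  rearrange = solve 4 (λ a b c d → (a :+ b) :- (c :+ d) := (a :- c) :+ (b :- d)) refl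
    where open +-*-Solver

  factor : ∀ q a b → q * a - q * b ≡ q * (a - b)
  factor = solve 3 (λ q a b → q :* a :- q :* b := q :* (a :- b)) refl
    where open +-*-Solver

  q≤q+1 : ∀ q → q ≤ q + 1ℚ
  q≤q+1 q = subst (_≤ q + 1ℚ) (+-identityʳ q) (+-monoʳ-≤ q (nonNegative⁻¹ 1ℚ))

_+ℝ_ : ℝ → ℝ → ℝ
x +ℝ y = mkℝ (λ n → seq x n + seq y n) λ ε 0<ε →
  let (M , x-cauchy) = cauchy x (½ * ε) (0<½ε 0<ε)
      (N , y-cauchy) = cauchy y (½ * ε) (0<½ε 0<ε)
  in M ℕ.⊔ N , λ m n p q →
     let open ≤-Reasoning
         dx = seq x m - seq x n
         dy = seq y m - seq y n
     in begin-strict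
       ∣ (seq x m + seq y m) - (seq x n + seq y n) ∣
         ≡⟨ cong ∣_∣ (rearrange (seq x m) (seq y m) (seq x n) (seq y n)) ⟩
       ∣ dx + dy ∣
         ≤⟨ ∣p+q∣≤∣p∣+∣q∣ dx dy ⟩
       ∣ dx ∣ + ∣ dy ∣
         <⟨ +-mono-< (x-cauchy m n (ℕ.m⊔n≤o⇒m≤o M N p) (ℕ.m⊔n≤o⇒m≤o M N q))
                     (y-cauchy m n (ℕ.m⊔n≤o⇒n≤o M N p) (ℕ.m⊔n≤o⇒n≤o M N q)) ⟩
       ½ * ε + ½ * ε
         ≡⟨ half+half ε ⟩
       ε ∎

-- Only rational multiples of real numbers are needed below.
_·_ : ℚ → ℝ → ℝ
q · x = mkℝ (λ n → q * seq x n) λ ε 0<ε →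
  let instance
        B>0 : Positive (∣ q ∣ + 1ℚ)
        B>0 = nonNeg+pos⇒pos ∣ q ∣ {{nonNegative (0≤∣p∣ q)}} 1ℚ
        B≢0 : NonZeroℚ (∣ q ∣ + 1ℚ)
        B≢0 = pos⇒nonZero (∣ q ∣ + 1ℚ)
        B⁻¹>0 : Positive (1/ (∣ q ∣ + 1ℚ))
        B⁻¹>0 = 1/pos⇒pos (∣ q ∣ + 1ℚ)
      B = ∣ q ∣ + 1ℚ
      δ = 1/ B * ε
      0<δ = positive⁻¹ δ {{pos*pos⇒pos (1/ B) ε {{positive 0<ε}}}}
      (N , x-cauchy) = cauchy x δ 0<δ
  in N , λ m n N≤m N≤n →
     let open ≤-Reasoning
         d = seq x m - seq x n
     in begin-strict
       ∣ q * seq x m - q * seq x n ∣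
         ≡⟨ cong ∣_∣ (factor q (seq x m) (seq x n)) ⟩
       ∣ q * d ∣
         ≡⟨ ∣p*q∣≡∣p∣*∣q∣ q d ⟩
       ∣ q ∣ * ∣ d ∣
         ≤⟨ *-monoʳ-≤-nonNeg ∣ d ∣ {{nonNegative (0≤∣p∣ d)}} (q≤q+1 ∣ q ∣) ⟩
       B * ∣ d ∣
         <⟨ *-monoʳ-<-pos B (x-cauchy m n N≤m N≤n) ⟩
       B * (1/ B * ε)
         ≡⟨ sym (*-assoc B (1/ B) ε) ⟩
       (B * 1/ B) * ε
         ≡⟨ cong (_* ε) (*-inverseʳ B) ⟩
       1ℚ * ε
         ≡⟨ *-identityˡ ε ⟩
       ε ∎

_-ℝ_ : ℝ → ℝ → ℝ
x -ℝ y = x +ℝ (- 1ℚ) · y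

_÷_ : ℝ → (d : ℕ) .{{_ : NonZero d}} → ℝ
x ÷ d = (+ 1 / d) · x

+ℝ-0ℝ-rawMonoid : RawMonoid 0ℓ 0ℓ
+ℝ-0ℝ-rawMonoid = record { Carrier = ℝ ; _≈_ = _≈ℝ_ ; _∙_ = _+ℝ_ ; ε = 0ℝ }

open RawMonoidDefs +ℝ-0ℝ-rawMonoid public using (sum)

------------------------------------------------------------------------

ℝ^ : ℕ → Set
ℝ^ n = Vector ℝ n

infix 4 _≋_

_≋_ : ∀ {n} → Rel (ℝ^ n) 0ℓ
_≋_ = Pointwise _≈ℝ_

e : ∀ {n} → Fin n → ℝ^ n
e i j with i ≟ j
... | yes _ = fromℚ 1ℚ
... | no  _ = 0ℝ

Lattice : ∀ {r d} → Vector (ℝ^ d) r → Pred (ℝ^ d) 0ℓ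
Lattice {r} w a =
  Σ (Vector ℤ r) λ c → a ≋ (λ i → sum {r} (λ j → (c j / 1) · w j i))

ℤ^ : (n : ℕ) → Pred (ℝ^ n) 0ℓ
ℤ^ n x = Σ (Vector ℤ n) λ z → x ≋ (λ i → fromℤ (z i))

ℝ≥0^ : (n : ℕ) → Pred (ℝ^ n) 0ℓ
ℝ≥0^ n a = ∀ i → 0ℝ ≤ℝ a i

------------------------------------------------------------------------
-- Indices start at 0: `b i` is the (i+1)-st bond, and `inject₁ i` and
-- `suc i` are consecutive coordinates.

deg : ∀ {n} → ℝ^ n → ℝ
deg a = sum a

module _ {n : ℕ} (b : Vector ℕ n) .{{_ : ∀ {i} → NonZero (b i)}} where

  v : Vector (ℝ^ (suc n)) (suc n)
  v j with view j
  ... | ‵inject₁ i = λ l → (e (inject₁ i) l -ℝ e (suc i) l) ÷ b i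
  ... | ‵fromℕ     = e (fromℕ n)

  L : Pred (ℝ^ (suc n)) 0ℓ
  L = Lattice v

  Π : Pred (ℝ^ (suc n)) 0ℓ
  Π = L ∩ ℝ≥0^ (suc n)

  Π-of-degree : ℕ → Pred (ℝ^ (suc n)) 0ℓ
  Π-of-degree k = Π ∩ λ a → deg a ≈ℝ fromℤ (+ k)

-- The inner sum runs over all coordinates with index at most i.
φ : ∀ {n} → Vector ℕ n → ℝ^ (suc n) → ℝ^ n
φ b a i = (+ b i / 1) · sum (λ (j : Fin′ (suc i)) → a (inject {i = suc i} j))

-- The dilated polytope k · P(b), for b of length n = m + 1.
_·P⟨_⟩ : ∀ (k : ℕ) {m} (b : Vector ℕ (suc m)) .{{_ : ∀ {i} → NonZero (b i)}} → Pred (ℝ^ (suc m)) 0ℓ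
_·P⟨_⟩ k {m} b x =
    0ℝ ≤ℝ x zero ÷ b zero
  × (∀ (i : Fin m) → x (inject₁ i) ÷ b (inject₁ i) ≤ℝ x (suc i) ÷ b (suc i))
  × x (fromℕ m) ÷ b (fromℕ m) ≤ℝ fromℤ (+ k)

-- f maps A into B, and the restricted map A → B is a bijection, where points
-- of the subsets are compared by `_≋_` in the ambient space.
RestrictsToBijection : ∀ {m n} → (ℝ^ m → ℝ^ n) → Pred (ℝ^ m) 0ℓ → Pred (ℝ^ n) 0ℓ → Set
RestrictsToBijection f A B =
  Σ (∀ a → A a → B (f a)) λ maps →
    IsBijection {A = ∃ A} (_≋_ on proj₁) {B = ∃ B} (_≋_ on proj₁)
      (λ (a , a∈A) → f a , maps a a∈A)

{-# OPTIONS --safe #-}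

-- A degree-k lattice point a with coefficients c has partial sums
-- c₁/b₁, …, cₙ/bₙ, k.  Hence φ(a) = (c₁,…,cₙ) is integral, and the coordinates
-- of a are the consecutive differences of (x₁/b₁,…,xₙ/bₙ,k) for x = φ(a): they are
-- all non-negative exactly when x lies in k·P(b).  Conversely x determines these
-- partial sums, and with them a.

module Submission where

open import Defs
open import Data.Fin using (Fin; zero; suc; inject; inject₁; fromℕ; punchIn; _≟_)
open import Data.Fin.Induction using (<-weakInduction)
open import Data.Fin.Properties using (punchInᵢ≢i; suc-injective)
open import Data.Fin.Relation.Unary.Top using (View; view; view-inject₁; view-fromℕ; ‵fromℕ; ‵inject₁)
open import Data.Integer using (ℤ) renaming (+_ to pos)
open import Data.Nat as ℕ using (ℕ; zero; suc; NonZero)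
import Data.Nat.Properties as ℕ
open import Data.Product using (∃-syntax; _×_; _,_; proj₁)
open import Data.Rational
  using (ℚ; _/_; _+_; _*_; _-_; -_; ∣_∣; 0ℚ; 1ℚ; _≤_; _<_; Positive; positive; 1/_; ½; toℚᵘ)
open import Data.Rational.Properties hiding (_≟_)
open import Data.Rational.Solver using (module +-*-Solver)
import Data.Rational.Unnormalised as ℚᵘ
import Data.Rational.Unnormalised.Properties as ℚᵘ
open import Algebra.Properties.CommutativeMonoid.Sum +-0-commutativeMonoid
  using (sum-cong-≗; sum-replicate-zero; sum-init-last; sum-remove; ∑-distrib-+)
  renaming (sum to sumℚ)
open import Data.Sum using (inj₁; inj₂)
open import Data.Vec.Functional using (Vector; tail; removeAt)
open import Function using (_∘_)
open import Relation.Binary using (Rel; IsEquivalence)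
open import Relation.Binary.PropositionalEquality
import Relation.Binary.Construct.On as On
open import Relation.Nullary using (yes; no; contradiction)
open import Relation.Unary using (_∩_)
open import Level using (0ℓ)

private variable
  A : Set
  n : ℕ

-- The relations of Defs on the underlying rational sequences, wrapped in records
-- so that the sequences can be inferred by unification.

infix 4 _≈_ _≲_

record _≈_ (s t : ℕ → ℚ) : Set where
  constructor ≈-intro
  field
    ≈-elim : ∀ ε → 0ℚ < ε → ∃[ N ] (∀ n → N ℕ.≤ n → ∣ s n - t n ∣ < ε)

record _≲_ (s t : ℕ → ℚ) : Set where
  constructor ≲-intro
  field
    ≲-elim : ∀ ε → 0ℚ < ε → ∃[ N ] (∀ n → N ℕ.≤ n → s n ≤ t n + ε)

open _≈_
open _≲_

-- Calculus of asymptotic equality and order on rational sequences.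

private variable
  s t u w : ℕ → ℚ

≲⇒≤ℝ : ∀ x y → seq x ≲ seq y → x ≤ℝ y
≲⇒≤ℝ x y = ≲-elim

≤ℝ⇒≲ : ∀ x y → x ≤ℝ y → seq x ≲ seq y
≤ℝ⇒≲ x y = ≲-intro

≈⇒≈ℝ : ∀ x y → seq x ≈ seq y → x ≈ℝ y
≈⇒≈ℝ x y = ≈-elim

≈ℝ⇒≈ : ∀ x y → x ≈ℝ y → seq x ≈ seq y
≈ℝ⇒≈ x y = ≈-intro

½+½ : ∀ ε → ½ * ε + ½ * ε ≡ ε
½+½ ε = trans (sym (*-distribʳ-+ ε ½ ½)) (*-identityˡ ε)

0<½* : ∀ {ε} → 0ℚ < ε → 0ℚ < ½ * ε
0<½* {ε} 0<ε = positive⁻¹ (½ * ε) {{pos*pos⇒pos ½ ε {{positive 0<ε}}}}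

∣p-q∣≡∣q-p∣ : ∀ p q → ∣ p - q ∣ ≡ ∣ q - p ∣
∣p-q∣≡∣q-p∣ p q = trans (sym (∣-p∣≡∣p∣ (p - q))) (cong ∣_∣ (lemma p q))
  where
    open +-*-Solver
    lemma : ∀ p q → - (p - q) ≡ q - p
    lemma = solve 2 (λ p q → :- (p :- q) := q :- p) refl

neg≡-1* : ∀ p → - p ≡ - 1ℚ * p
neg≡-1* p = trans (cong -_ (sym (*-identityˡ p))) (neg-distribˡ-* 1ℚ p)

p≤∣p∣ : ∀ p → p ≤ ∣ p ∣
p≤∣p∣ p with ≤-total 0ℚ p
... | inj₁ 0≤p = ≤-reflexive (sym (0≤p⇒∣p∣≡p 0≤p))
... | inj₂ p≤0 = ≤-trans p≤0 (0≤∣p∣ p)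

≗⇒≈ : s ≗ t → s ≈ t
≗⇒≈ {t = t} s≗t .≈-elim ε 0<ε = 0 , λ n _ →
  subst (_< ε) (sym (cong ∣_∣ (trans (cong (_- t n) (s≗t n)) (+-inverseʳ (t n))))) 0<ε

≈-refl : s ≈ s
≈-refl = ≗⇒≈ λ _ → refl

≈-sym : s ≈ t → t ≈ s
≈-sym {s} {t} s≈t .≈-elim ε 0<ε =
  let (N , close) = s≈t .≈-elim ε 0<ε
  in N , λ n N≤n → subst (_< ε) (∣p-q∣≡∣q-p∣ (s n) (t n)) (close n N≤n)

+-cong-≈ : s ≈ t → u ≈ w → (λ n → s n + u n) ≈ (λ n → t n + w n)
+-cong-≈ {s} {t} {u} {w} s≈t u≈w .≈-elim ε 0<ε =
  let (M , close₁) = s≈t .≈-elim (½ * ε) (0<½* 0<ε)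
      (N , close₂) = u≈w .≈-elim (½ * ε) (0<½* 0<ε)
  in M ℕ.⊔ N , λ n p →
     let open ≤-Reasoning in begin-strict
       ∣ (s n + u n) - (t n + w n) ∣
         ≡⟨ cong ∣_∣ (rearrange (s n) (u n) (t n) (w n)) ⟩
       ∣ (s n - t n) + (u n - w n) ∣
         ≤⟨ ∣p+q∣≤∣p∣+∣q∣ (s n - t n) (u n - w n) ⟩
       ∣ s n - t n ∣ + ∣ u n - w n ∣
         <⟨ +-mono-< (close₁ n (ℕ.m⊔n≤o⇒m≤o M N p)) (close₂ n (ℕ.m⊔n≤o⇒n≤o M N p)) ⟩
       ½ * ε + ½ * ε
         ≡⟨ ½+½ ε ⟩
       ε ∎
  where
    rearrange : ∀ a b c d → (a + b) - (c + d) ≡ (a - c) + (b - d)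
    rearrange = solve 4 (λ a b c d → (a :+ b) :- (c :+ d) := (a :- c) :+ (b :- d)) refl
      where open +-*-Solver

≈-trans : s ≈ t → t ≈ u → s ≈ u
≈-trans {s} {t} {u} s≈t t≈u .≈-elim ε 0<ε =
  -- Adding the two relations leaves the splitting of ε to `+-cong-≈`; the middle sequence cancels
  -- in the difference.
  let (N , close) = +-cong-≈ s≈t t≈u .≈-elim ε 0<ε
  in N , λ n N≤n → subst (λ d → ∣ d ∣ < ε) (cancel (s n) (t n) (u n)) (close n N≤n)
  where
    cancel : ∀ a b c → (a + b) - (b + c) ≡ a - c
    cancel = solve 3 (λ a b c → (a :+ b) :- (b :+ c) := a :- c) refl
      where open +-*-Solver

*-congˡ-≈ : ∀ q → s ≈ t → (λ n → q * s n) ≈ (λ n → q * t n)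
*-congˡ-≈ {s} {t} q s≈t .≈-elim ε 0<ε =
  let (N , close) = s≈t .≈-elim (1/ B * ε) 0<δ
  in N , λ n N≤n →
     let open ≤-Reasoning
         d = s n - t n
     in begin-strict
       ∣ q * s n - q * t n ∣ ≡⟨ cong ∣_∣ (factor q (s n) (t n)) ⟩
       ∣ q * d ∣             ≡⟨ ∣p*q∣≡∣p∣*∣q∣ q d ⟩
       ∣ q ∣ * ∣ d ∣         ≤⟨ *-monoʳ-≤-nonNeg ∣ d ∣ {{∣-∣-nonNeg d}} ∣q∣≤B ⟩
       B * ∣ d ∣             <⟨ *-monoʳ-<-pos B (close n N≤n) ⟩
       B * (1/ B * ε)        ≡⟨ *-assoc B (1/ B) ε ⟨
       (B * 1/ B) * ε        ≡⟨ cong (_* ε) (*-inverseʳ B) ⟩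
       1ℚ * ε                ≡⟨ *-identityˡ ε ⟩
       ε                     ∎
  where
    -- The added 1 keeps the bound positive when `q` is zero, so that ε / `B` is a legitimate
    -- tolerance.
    B = ∣ q ∣ + 1ℚ
    instance
      B>0 : Positive B
      B>0 = nonNeg+pos⇒pos ∣ q ∣ {{∣-∣-nonNeg q}} 1ℚ
      B≢0 = pos⇒nonZero B
      B⁻¹>0 : Positive (1/ B)
      B⁻¹>0 = 1/pos⇒pos B
    0<δ : 0ℚ < 1/ B * ε
    0<δ = positive⁻¹ (1/ B * ε) {{pos*pos⇒pos (1/ B) ε {{positive 0<ε}}}}
    ∣q∣≤B : ∣ q ∣ ≤ B
    ∣q∣≤B = subst (_≤ B) (+-identityʳ ∣ q ∣) (+-monoʳ-≤ ∣ q ∣ (nonNegative⁻¹ 1ℚ))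
    factor : ∀ q a b → q * a - q * b ≡ q * (a - b)
    factor = solve 3 (λ q a b → q :* a :- q :* b := q :* (a :- b)) refl
      where open +-*-Solver

-‿cong-≈ : s ≈ t → u ≈ w → (λ n → s n - u n) ≈ (λ n → t n - w n)
-‿cong-≈ {u = u} {w = w} s≈t u≈w = +-cong-≈ s≈t
  (≈-trans (≗⇒≈ λ n → neg≡-1* (u n)) (≈-trans (*-congˡ-≈ (- 1ℚ) u≈w) (≗⇒≈ λ n → sym (neg≡-1* (w n)))))

≈⇒≲ : s ≈ t → s ≲ t
≈⇒≲ {s} {t} s≈t .≲-elim ε 0<ε =
  let (N , close) = s≈t .≈-elim ε 0<ε
  in N , λ n N≤n →
     let open ≤-Reasoning in begin
       s n               ≡⟨ split (s n) (t n) ⟩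
       t n + (s n - t n) ≤⟨ +-monoʳ-≤ (t n) (≤-trans (p≤∣p∣ _) (<⇒≤ (close n N≤n))) ⟩
       t n + ε           ∎
  where
    split : ∀ a b → a ≡ b + (a - b)
    split = solve 2 (λ a b → a := b :+ (a :- b)) refl
      where open +-*-Solver

+-mono-≲ : s ≲ t → u ≲ w → (λ n → s n + u n) ≲ (λ n → t n + w n)
+-mono-≲ {s} {t} {u} {w} s≲t u≲w .≲-elim ε 0<ε =
  let (M , below₁) = s≲t .≲-elim (½ * ε) (0<½* 0<ε)
      (N , below₂) = u≲w .≲-elim (½ * ε) (0<½* 0<ε)
  in M ℕ.⊔ N , λ n p →
     let open ≤-Reasoning in begin
       s n + u n
         ≤⟨ +-mono-≤ (below₁ n (ℕ.m⊔n≤o⇒m≤o M N p)) (below₂ n (ℕ.m⊔n≤o⇒n≤o M N p)) ⟩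
       (t n + ½ * ε) + (w n + ½ * ε)
         ≡⟨ rearrange (t n) (w n) (½ * ε) ⟩
       (t n + w n) + (½ * ε + ½ * ε)
         ≡⟨ cong (t n + w n +_) (½+½ ε) ⟩
       t n + w n + ε ∎
  where
    rearrange : ∀ a b c → (a + c) + (b + c) ≡ (a + b) + (c + c)
    rearrange = solve 3 (λ a b c → (a :+ c) :+ (b :+ c) := (a :+ b) :+ (c :+ c)) refl
      where open +-*-Solver

≲-trans : s ≲ t → t ≲ u → s ≲ u
≲-trans {s} {t} {u} s≲t t≲u .≲-elim ε 0<ε =
  -- As for `≈-trans`: add the two inequalities, then cancel `t n` from both sides.
  let (N , below) = +-mono-≲ s≲t t≲u .≲-elim ε 0<ε
  in N , λ n N≤n → +-cancelʳ-≤ (t n) (s n) (u n + ε)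
       (subst (s n + t n ≤_) (swap (t n) (u n) ε) (below n N≤n))
  where
    +-cancelʳ-≤ : ∀ r p q → p + r ≤ q + r → p ≤ q
    +-cancelʳ-≤ r p q p+r≤q+r =
      subst₂ _≤_ (cancel p r) (cancel q r) (+-monoˡ-≤ (- r) p+r≤q+r)
      where
        cancel : ∀ a b → a + b - b ≡ a
        cancel = solve 2 (λ a b → a :+ b :- b := a) refl
          where open +-*-Solver
    swap : ∀ a b c → a + b + c ≡ b + c + a
    swap = solve 3 (λ a b c → a :+ b :+ c := b :+ c :+ a) refl
      where open +-*-Solver

-- With its converse below, this translates the inequalities of the polytope into signs of
-- consecutive differences, which are the coordinates of a path.
s≲t⇒0≲t-s : s ≲ t → (λ _ → 0ℚ) ≲ (λ n → t n - s n)
s≲t⇒0≲t-s {s} {t} s≲t = ≲-trans (≈⇒≲ (≗⇒≈ λ n → sym (+-inverseʳ (s n))))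
  (+-mono-≲ s≲t (≈⇒≲ ≈-refl))

0≲t-s⇒s≲t : (λ _ → 0ℚ) ≲ (λ n → t n - s n) → s ≲ t
0≲t-s⇒s≲t {t} {s} 0≲t-s = ≲-trans (≈⇒≲ (≗⇒≈ λ n → sym (+-identityˡ (s n))))
  (≲-trans (+-mono-≲ 0≲t-s (≈⇒≲ ≈-refl)) (≈⇒≲ (≗⇒≈ λ n → cancel (t n) (s n))))
  where
    cancel : ∀ a b → a - b + b ≡ a
    cancel = solve 2 (λ a b → a :- b :+ b := a) refl
      where open +-*-Solver

-- Partial sums and consecutive differences of rational vectors.

prefix : Vector ℚ (suc n) → Vector ℚ (suc n)
prefix             a zero    = a zero
prefix {n = suc _} a (suc i) = a zero + prefix (tail a) i

Δ : Vector ℚ (suc n) → Vector ℚ (suc n)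
Δ a zero    = a zero
Δ a (suc i) = a (suc i) - a (inject₁ i)

-- `prefix` peels off the first entry, as `sumℚ` does, while `Δ` compares an entry with its
-- predecessor. This recurrence at the far end is what makes the two telescope against each other.
prefix-suc : ∀ (a : Vector ℚ (suc n)) i → prefix a (suc i) ≡ prefix a (inject₁ i) + a (suc i)
prefix-suc {suc _} a zero    = refl
prefix-suc {suc _} a (suc i) =
  trans (cong (a zero +_) (prefix-suc (tail a) i)) (sym (+-assoc (a zero) _ _))

prefix-cong : ∀ {a a′ : Vector ℚ (suc n)} → a ≗ a′ → prefix a ≗ prefix a′
prefix-cong             eq zero    = eq zero
prefix-cong {n = suc _} eq (suc i) = cong₂ _+_ (eq zero) (prefix-cong (eq ∘ suc) i)

prefix-Δ : ∀ (d : Vector ℚ (suc n)) → prefix (Δ d) ≗ d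
prefix-Δ d = <-weakInduction (λ i → prefix (Δ d) i ≡ d i) refl λ i ih →
  trans (prefix-suc (Δ d) i) (trans (cong (_+ Δ d (suc i)) ih) (cancel (d (inject₁ i)) (d (suc i))))
  where
    cancel : ∀ a b → a + (b - a) ≡ b
    cancel = solve 2 (λ a b → a :+ (b :- a) := b) refl
      where open +-*-Solver

Δ-prefix : ∀ (a : Vector ℚ (suc n)) → Δ (prefix a) ≗ a
Δ-prefix a zero    = refl
Δ-prefix a (suc i) =
  trans (cong (_- prefix a (inject₁ i)) (prefix-suc a i)) (cancel (prefix a (inject₁ i)) (a (suc i)))
  where
    cancel : ∀ a b → a + b - a ≡ b
    cancel = solve 2 (λ a b → a :+ b :- a := b) refl
      where open +-*-Solver

-- The left side is the inner sum of `φ`. The index is `inject₁ i` because a path has one coordinate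
-- more than its image.
prefix-inject₁ : ∀ (a : Vector ℚ (suc n)) i →
                 sumℚ (λ j → a (inject {i = suc i} j)) ≡ prefix a (inject₁ i)
prefix-inject₁ a zero    = +-identityʳ (a zero)
prefix-inject₁ a (suc i) = cong (a zero +_) (prefix-inject₁ (tail a) i)

prefix-fromℕ : ∀ (a : Vector ℚ (suc n)) → sumℚ a ≡ prefix a (fromℕ n)
prefix-fromℕ {zero}  a = +-identityʳ (a zero)
prefix-fromℕ {suc _} a = cong (a zero +_) (prefix-fromℕ (tail a))

-- Opaque so that conversion checking does not unfold vectors of reals.
opaque
  snoc : Vector A n → A → Vector A (suc n)
  snoc xs x i with view i
  ... | ‵inject₁ j = xs j
  ... | ‵fromℕ     = x

  snoc-inject₁ : ∀ (xs : Vector A n) x i → snoc xs x (inject₁ i) ≡ xs i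
  snoc-inject₁ xs x i rewrite view-inject₁ i = refl

  snoc-fromℕ : ∀ (xs : Vector A n) x → snoc xs x (fromℕ n) ≡ x
  snoc-fromℕ {n = n} xs x rewrite view-fromℕ n = refl

last-induction : (P : Fin (suc n) → Set) → (∀ i → P (inject₁ i)) → P (fromℕ n) → ∀ i → P i
last-induction P Pinject₁ Pfromℕ i with view i
... | ‵inject₁ j = Pinject₁ j
... | ‵fromℕ     = Pfromℕ

-- Sums against the canonical basis.

seq-sum : ∀ (x : ℝ^ n) m → seq (sum x) m ≡ sumℚ (λ i → seq (x i) m)
seq-sum {zero}  x m = refl
seq-sum {suc _} x m = cong (seq (x zero) m +_) (seq-sum (tail x) m)

seq-e-refl : ∀ (i : Fin n) m → seq (e i i) m ≡ 1ℚ
seq-e-refl i m with i ≟ i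
... | yes _  = refl
... | no i≢i = contradiction refl i≢i

seq-e-≢ : ∀ {i j : Fin n} m → i ≢ j → seq (e i j) m ≡ 0ℚ
seq-e-≢ {i = i} {j} m i≢j with i ≟ j
... | yes i≡j = contradiction i≡j i≢j
... | no _    = refl

sum-zero : ∀ (t : Vector ℚ n) → (∀ j → t j ≡ 0ℚ) → sumℚ t ≡ 0ℚ
sum-zero {n} t t≡0 = trans (sum-cong-≗ t≡0) (sum-replicate-zero n)

sum-single : ∀ (t : Vector ℚ n) i → (∀ j → j ≢ i → t j ≡ 0ℚ) → sumℚ t ≡ t i
sum-single {suc _} t i t≡0 = begin
  sumℚ t                      ≡⟨ sum-remove {i = i} t ⟩
  t i + sumℚ (removeAt t i)   ≡⟨ cong (t i +_) (sum-zero (removeAt t i) λ j → t≡0 (punchIn i j) (punchInᵢ≢i i j)) ⟩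
  t i + 0ℚ                    ≡⟨ +-identityʳ (t i) ⟩
  t i                         ∎
  where open ≡-Reasoning

-- Injectivity of `f` leaves only the term at `i`. It is applied with the identity for the vectors
-- e_j and with `suc` for the vectors e_{j+1}.
sum-*-e : ∀ {r} (g : Vector ℚ n) (f : Fin n → Fin r) → (∀ {i j} → f i ≡ f j → i ≡ j) → ∀ i m →
          sumℚ (λ j → g j * seq (e (f j) (f i)) m) ≡ g i
sum-*-e g f f-inj i m = begin
  sumℚ (λ j → g j * seq (e (f j) (f i)) m)
    ≡⟨ sum-single _ i (λ j j≢i → trans (cong (g j *_) (seq-e-≢ m (j≢i ∘ f-inj))) (*-zeroʳ (g j))) ⟩
  g i * seq (e (f i) (f i)) m  ≡⟨ cong (g i *_) (seq-e-refl (f i) m) ⟩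
  g i * 1ℚ                     ≡⟨ *-identityʳ (g i) ⟩
  g i                          ∎
  where open ≡-Reasoning

-- Summation by parts: the sum of d_j (e_j - e_{j+1}) plus the last d times the last e has d_l -
-- d_{l-1} at coordinate l. The terms enter as a vector `t` known only through two equations,
-- matching the two cases in the definition of `v`.
sum-*-Δe : ∀ (d t : Vector ℚ (suc n)) l m →
           (∀ i → t (inject₁ i) ≡ d (inject₁ i) * (seq (e (inject₁ i) l) m - seq (e (suc i) l) m)) →
           t (fromℕ n) ≡ d (fromℕ n) * seq (e (fromℕ n) l) m →
           sumℚ t ≡ Δ d l
sum-*-Δe {n} d t l m t-inject₁ t-fromℕ = begin
  sumℚ t
    ≡⟨ sum-init-last t ⟩
  sumℚ (t ∘ inject₁) + t (fromℕ n)
    ≡⟨ cong₂ _+_ (trans (sum-cong-≗ split) (∑-distrib-+ (p ∘ inject₁) q)) t-fromℕ ⟩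
  (sumℚ (p ∘ inject₁) + sumℚ q) + p (fromℕ n)
    ≡⟨ swap (sumℚ (p ∘ inject₁)) (sumℚ q) (p (fromℕ n)) ⟩
  (sumℚ (p ∘ inject₁) + p (fromℕ n)) + sumℚ q
    ≡⟨ cong (_+ sumℚ q) (sum-init-last p) ⟨
  sumℚ p + sumℚ q
    ≡⟨ cong (_+ sumℚ q) (sum-*-e d (λ j → j) (λ eq → eq) l m) ⟩
  d l + sumℚ q
    ≡⟨ sum-shifted l ⟩
  Δ d l ∎
  where
    open ≡-Reasoning
    -- `p` collects the e_j, including the last generator, and `q` the shifted terms -e_{j+1}.
    p : Vector ℚ (suc n)
    p j = d j * seq (e j l) m
    q : Vector ℚ n
    q i = - d (inject₁ i) * seq (e (suc i) l) m

    split : ∀ i → t (inject₁ i) ≡ p (inject₁ i) + q i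
    split i = trans (t-inject₁ i) (distrib (d (inject₁ i)) _ _)
      where
        distrib : ∀ x y z → x * (y - z) ≡ x * y + - x * z
        distrib = solve 3 (λ x y z → x :* (y :- z) := x :* y :+ :- x :* z) refl
          where open +-*-Solver

    swap : ∀ x y z → (x + y) + z ≡ (x + z) + y
    swap = solve 3 (λ x y z → (x :+ y) :+ z := (x :+ z) :+ y) refl
      where open +-*-Solver

    sum-shifted : ∀ l → d l + sumℚ (λ i → - d (inject₁ i) * seq (e (suc i) l) m) ≡ Δ d l
    -- No shifted basis vector meets coordinate zero; at `suc l` exactly the term with index `l`
    -- survives.
    sum-shifted zero = trans
      (cong (d zero +_) (sum-zero _ λ i →
        trans (cong (- d (inject₁ i) *_) (seq-e-≢ {i = suc i} {zero} m λ ())) (*-zeroʳ (- d (inject₁ i)))))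
      (+-identityʳ (d zero))
    sum-shifted (suc l) = cong (d (suc l) +_) (sum-*-e (λ i → - d (inject₁ i)) suc suc-injective l m)

-- Cancelling a bond, and the rational sequences behind scaled reals.

1/d*d≡1 : ∀ d .{{_ : NonZero d}} → (pos 1 / d) * (pos d / 1) ≡ 1ℚ
-- `_/_` reduces fractions to lowest terms; unnormalised rationals avoid the gcd.
1/d*d≡1 (suc d) = toℚᵘ-injective (begin-equality
  toℚᵘ ((pos 1 / suc d) * (pos (suc d) / 1))
    ≃⟨ toℚᵘ-homo-* (pos 1 / suc d) (pos (suc d) / 1) ⟩
  toℚᵘ (pos 1 / suc d) ℚᵘ.* toℚᵘ (pos (suc d) / 1)
    ≃⟨ ℚᵘ.*-cong (toℚᵘ-fromℚᵘ (pos 1 ℚᵘ./ suc d)) (toℚᵘ-fromℚᵘ (pos (suc d) ℚᵘ./ 1)) ⟩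
  (pos 1 ℚᵘ./ suc d) ℚᵘ.* (pos (suc d) ℚᵘ./ 1)
    ≃⟨ ℚᵘ.*-inverseˡ (pos (suc d) ℚᵘ./ 1) ⟩
  ℚᵘ.1ℚᵘ ∎)
  where open ℚᵘ.≤-Reasoning

1/d*[d*q]≡q : ∀ d .{{_ : NonZero d}} q → (pos 1 / d) * ((pos d / 1) * q) ≡ q
1/d*[d*q]≡q d q = trans (sym (*-assoc (pos 1 / d) (pos d / 1) q))
  (trans (cong (_* q) (1/d*d≡1 d)) (*-identityˡ q))

d*[1/d*q]≡q : ∀ d .{{_ : NonZero d}} q → (pos d / 1) * ((pos 1 / d) * q) ≡ q
d*[1/d*q]≡q d q = trans (sym (*-assoc (pos d / 1) (pos 1 / d) q))
  (trans (cong (_* q) (trans (*-comm (pos d / 1) (pos 1 / d)) (1/d*d≡1 d))) (*-identityˡ q))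

seq-· : ∀ q x m → seq (q · x) m ≡ q * seq x m
seq-· q x m = refl

seq-÷ : ∀ x d .{{_ : NonZero d}} m → seq (x ÷ d) m ≡ (pos 1 / d) * seq x m
seq-÷ x d m = refl

seq-fromℤ : ∀ z m → seq (fromℤ z) m ≡ z / 1
seq-fromℤ z m = refl

seq--ℝ : ∀ x y m → seq (x -ℝ y) m ≡ seq x m - seq y m
seq--ℝ x y m = cong (seq x m +_) (sym (neg≡-1* (seq y m)))

-- The scalar is regrouped in front so that it becomes an entry of `levels`.
seq-·-÷ : ∀ q x y d .{{_ : NonZero d}} m →
          seq (q · ((x -ℝ y) ÷ d)) m ≡ (pos 1 / d) * q * (seq x m - seq y m)
seq-·-÷ q x y d m = begin
  seq (q · ((x -ℝ y) ÷ d)) m              ≡⟨ seq-· q ((x -ℝ y) ÷ d) m ⟩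
  q * seq ((x -ℝ y) ÷ d) m                ≡⟨ cong (q *_) (seq-÷ (x -ℝ y) d m) ⟩
  q * ((pos 1 / d) * seq (x -ℝ y) m)      ≡⟨ cong (λ r → q * ((pos 1 / d) * r)) (seq--ℝ x y m) ⟩
  q * ((pos 1 / d) * (seq x m - seq y m)) ≡⟨ reassoc q (pos 1 / d) (seq x m - seq y m) ⟩
  (pos 1 / d) * q * (seq x m - seq y m)   ∎
  where
    open ≡-Reasoning
    reassoc : ∀ x y z → x * (y * z) ≡ y * x * z
    reassoc = solve 3 (λ x y z → x :* (y :* z) := y :* x :* z) refl
      where open +-*-Solver

-- Lattice combinations, `φ` and the degree in terms of rational sequences.

infix 4 _≋ˢ_

_≋ˢ_ : Rel (ℝ^ n) 0ℓ
x ≋ˢ y = ∀ i → seq (x i) ≈ seq (y i)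

-- Opaque because conversion checking is intractable on unfolded combinations of
-- the vectors v b.
opaque
  combination : ∀ {r d} → Vector (ℝ^ d) r → Vector ℤ r → ℝ^ d
  combination w c i = sum (λ j → (c j / 1) · w j i)

  seq-combination : ∀ {r d} (w : Vector (ℝ^ d) r) c i m →
                    seq (combination w c i) m ≡ sumℚ (λ j → seq ((c j / 1) · w j i) m)
  seq-combination w c i m = seq-sum (λ j → (c j / 1) · w j i) m

  combination∈Lattice : ∀ {r d} (w : Vector (ℝ^ d) r) c → Lattice w (combination w c)
  combination∈Lattice w c = c , λ i → ≈-refl {seq (combination w c i)} .≈-elim

  Lattice⇒combination : ∀ {r d} (w : Vector (ℝ^ d) r) {a} → Lattice w a → ∃[ c ] (a ≋ˢ combination w c)
  Lattice⇒combination w (c , a≋) = c , λ i → ≈-intro (a≋ i)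

coords : ℝ^ n → ℕ → Vector ℚ n
coords x m i = seq (x i) m

seq-φ : ∀ (b : Vector ℕ n) a i m → seq (φ b a i) m ≡ (pos (b i) / 1) * prefix (coords a m) (inject₁ i)
seq-φ b a i m = cong ((pos (b i) / 1) *_)
  (trans (seq-sum (λ j → a (inject {i = suc i} j)) m) (prefix-inject₁ (coords a m) i))

seq-deg : ∀ (a : ℝ^ (suc n)) m → seq (deg a) m ≡ prefix (coords a m) (fromℕ n)
seq-deg a m = trans (seq-sum a m) (prefix-fromℕ (coords a m))

prefix-cong-≈ : ∀ {α β : ℕ → Vector ℚ (suc n)} → (∀ i → (λ m → α m i) ≈ (λ m → β m i)) →
                ∀ i → (λ m → prefix (α m) i) ≈ (λ m → prefix (β m) i)
prefix-cong-≈             α≈β zero    = α≈β zero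
prefix-cong-≈ {n = suc _} α≈β (suc i) = +-cong-≈ (α≈β zero) (prefix-cong-≈ (α≈β ∘ suc) i)

Δ-cong-≈ : ∀ {α β : ℕ → Vector ℚ (suc n)} → (∀ i → (λ m → α m i) ≈ (λ m → β m i)) →
           ∀ i → (λ m → Δ (α m) i) ≈ (λ m → Δ (β m) i)
Δ-cong-≈ α≈β zero    = α≈β zero
Δ-cong-≈ α≈β (suc i) = -‿cong-≈ (α≈β (suc i)) (α≈β (inject₁ i))

φ-cong : ∀ (b : Vector ℕ n) {a a′} → a ≋ˢ a′ → φ b a ≋ˢ φ b a′
φ-cong b {a} {a′} a≋a′ i = ≈-trans (≗⇒≈ (seq-φ b a i)) (≈-trans
  (*-congˡ-≈ (pos (b i) / 1) (prefix-cong-≈ {α = coords a} {β = coords a′} a≋a′ (inject₁ i)))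
  (≗⇒≈ λ m → sym (seq-φ b a′ i m)))

-- Partial sums of lattice points.

module _ (b : Vector ℕ n) .{{b≢0 : ∀ {i} → NonZero (b i)}} where

  -- Spelled out over the view of j, because rewriting by view-inject₁ would
  -- normalise the Cauchy proofs inside v.
  generator : ∀ {j : Fin (suc n)} → View j → ℝ^ (suc n)
  generator (‵inject₁ i) = λ l → (e (inject₁ i) l -ℝ e (suc i) l) ÷ b i
  generator ‵fromℕ       = e (fromℕ n)

  v≡generator : ∀ j → v b j ≡ generator (view j)
  v≡generator j with view j
  ... | ‵inject₁ i = refl
  ... | ‵fromℕ     = refl

  v-inject₁ : ∀ i → v b (inject₁ i) ≡ λ l → (e (inject₁ i) l -ℝ e (suc i) l) ÷ b i
  v-inject₁ i = trans (v≡generator (inject₁ i)) (cong generator (view-inject₁ i))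

  v-fromℕ : v b (fromℕ n) ≡ e (fromℕ n)
  v-fromℕ = trans (v≡generator (fromℕ n)) (cong generator (view-fromℕ n))

  -- The partial sums of the lattice point with coefficients c.
  levels : Vector ℤ (suc n) → Vector ℚ (suc n)
  levels c = snoc (λ i → (pos 1 / b i) * (c (inject₁ i) / 1)) (c (fromℕ n) / 1)

  levels-inject₁ : ∀ c i → levels c (inject₁ i) ≡ (pos 1 / b i) * (c (inject₁ i) / 1)
  levels-inject₁ c i = snoc-inject₁ (λ i → (pos 1 / b i) * (c (inject₁ i) / 1)) (c (fromℕ n) / 1) i

  levels-fromℕ : ∀ c → levels c (fromℕ n) ≡ c (fromℕ n) / 1
  levels-fromℕ c = snoc-fromℕ (λ i → (pos 1 / b i) * (c (inject₁ i) / 1)) (c (fromℕ n) / 1)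

  latticePoint : Vector ℤ (suc n) → ℝ^ (suc n)
  latticePoint = combination (v b)

  -- The difference e_i - e_{i+1} carries the weight c_i / b_i, and the last basis vector the last
  -- coefficient, so summation by parts applies with `levels c`. The equality is exact at each index
  -- of the sequences.
  coords-latticePoint : ∀ c m → coords (latticePoint c) m ≗ Δ (levels c)
  coords-latticePoint c m l = trans (seq-combination (v b) c l m)
    (sum-*-Δe (levels c) (λ j → seq ((c j / 1) · v b j l) m) l m
      (λ i → trans (cong (λ y → seq ((c (inject₁ i) / 1) · y l) m) (v-inject₁ i))
        (trans (seq-·-÷ (c (inject₁ i) / 1) (e (inject₁ i) l) (e (suc i) l) (b i) m)
          (cong (_* (seq (e (inject₁ i) l) m - seq (e (suc i) l) m)) (sym (levels-inject₁ c i)))))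
      (trans (cong (λ y → seq ((c (fromℕ n) / 1) · y l) m) v-fromℕ)
        (trans (seq-· (c (fromℕ n) / 1) (e (fromℕ n) l) m)
          (cong (_* seq (e (fromℕ n) l) m) (sym (levels-fromℕ c))))))

  prefix-latticePoint : ∀ {a c} → a ≋ˢ latticePoint c →
                        ∀ i → (λ m → prefix (coords a m) i) ≈ (λ _ → levels c i)
  prefix-latticePoint {a} {c} a≋ i = ≈-trans
    (prefix-cong-≈ {α = coords a} {β = coords (latticePoint c)} a≋ i)
    (≗⇒≈ λ m → trans (prefix-cong (coords-latticePoint c m) i) (prefix-Δ (levels c) i))

  -- The factor b_i in `φ` cancels the denominator of the partial sum c_i / b_i. This is where
  -- integrality comes from.
  φ-latticePoint : ∀ {a c} → a ≋ˢ latticePoint c → ∀ i → seq (φ b a i) ≈ seq (fromℤ (c (inject₁ i)))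
  φ-latticePoint {a} {c} a≋ i = ≈-trans (≗⇒≈ (seq-φ b a i)) (≈-trans
    (*-congˡ-≈ (pos (b i) / 1) (prefix-latticePoint {a} {c} a≋ (inject₁ i)))
    (≗⇒≈ λ _ → trans (cong ((pos (b i) / 1) *_) (levels-inject₁ c i))
                     (d*[1/d*q]≡q (b i) (c (inject₁ i) / 1))))

  deg-latticePoint : ∀ {a c} → a ≋ˢ latticePoint c → seq (deg a) ≈ seq (fromℤ (c (fromℕ n)))
  deg-latticePoint {a} {c} a≋ = ≈-trans (≗⇒≈ (seq-deg a)) (≈-trans
    (prefix-latticePoint {a} {c} a≋ (fromℕ n)) (≗⇒≈ λ _ → levels-fromℕ c))

  opaque
    scale : ℝ^ n → ℝ^ n
    scale x i = x i ÷ b i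

    scale≡÷ : ∀ x i → scale x i ≡ x i ÷ b i
    scale≡÷ x i = refl

  seq-scale : ∀ x i m → seq (scale x i) m ≡ (pos 1 / b i) * seq (x i) m
  seq-scale x i m = trans (cong (λ y → seq y m) (scale≡÷ x i)) (seq-÷ (x i) (b i) m)

  -- Recovering a path of degree k from its image.

  module _ (k : ℕ) where

    -- The sequence x₁/b₁, …, xₙ/bₙ, k whose monotonicity defines k·P(b).
    chain : ℝ^ n → ℝ^ (suc n)
    chain x = snoc (scale x) (fromℤ (pos k))

    chain-inject₁ : ∀ x i → chain x (inject₁ i) ≡ scale x i
    chain-inject₁ x i = snoc-inject₁ (scale x) (fromℤ (pos k)) i

    chain-fromℕ : ∀ x → chain x (fromℕ n) ≡ fromℤ (pos k)
    chain-fromℕ x = snoc-fromℕ (scale x) (fromℤ (pos k))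

    seq-chain-inject₁ : ∀ x i m → seq (chain x (inject₁ i)) m ≡ (pos 1 / b i) * seq (x i) m
    seq-chain-inject₁ x i m = trans (cong (λ w → seq w m) (chain-inject₁ x i)) (seq-scale x i m)

    seq-chain-fromℕ : ∀ x m → seq (chain x (fromℕ n)) m ≡ pos k / 1
    seq-chain-fromℕ x m = trans (cong (λ w → seq w m) (chain-fromℕ x)) (seq-fromℤ (pos k) m)

    -- Each comparison with a chain below splits into the scaled coordinates and the final entry k.
    chain-≈ : ∀ x {α : ℕ → Vector ℚ (suc n)} →
              (∀ i → (λ m → (pos 1 / b i) * seq (x i) m) ≈ (λ m → α m (inject₁ i))) →
              (λ _ → pos k / 1) ≈ (λ m → α m (fromℕ n)) →
              ∀ i → seq (chain x i) ≈ (λ m → α m i)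
    chain-≈ x {α} init≈ last≈ = last-induction (λ i → seq (chain x i) ≈ (λ m → α m i))
      (λ i → ≈-trans (≗⇒≈ (seq-chain-inject₁ x i)) (init≈ i))
      (≈-trans (≗⇒≈ (seq-chain-fromℕ x)) last≈)

    chain-cong : ∀ {x y} → x ≋ˢ y → chain x ≋ˢ chain y
    chain-cong {x} {y} x≋y = chain-≈ x {α = coords (chain y)}
      (λ i → ≈-trans (*-congˡ-≈ (pos 1 / b i) (x≋y i)) (≗⇒≈ λ m → sym (seq-chain-inject₁ y i m)))
      (≗⇒≈ λ m → sym (seq-chain-fromℕ y m))

    -- Dividing by b_i undoes the factor in `φ`; at the last index the degree hypothesis identifies
    -- the full sum with k.
    chain-φ : ∀ {a} → seq (deg a) ≈ seq (fromℤ (pos k)) →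
              ∀ i → seq (chain (φ b a) i) ≈ (λ m → prefix (coords a m) i)
    chain-φ {a} deg≈k = chain-≈ (φ b a) {α = λ m → prefix (coords a m)}
      (λ i → ≗⇒≈ λ m → trans (cong ((pos 1 / b i) *_) (seq-φ b a i m)) (1/d*[d*q]≡q (b i) _))
      (≈-trans (≈-sym deg≈k) (≗⇒≈ (seq-deg a)))

    -- An integral point thus has the partial sums of the lattice point with coefficients `z`
    -- followed by k, its future preimage.
    chain-levels : ∀ {x z} → x ≋ˢ (λ i → fromℤ (z i)) →
                   ∀ i → seq (chain x i) ≈ (λ _ → levels (snoc z (pos k)) i)
    chain-levels {x} {z} x≋z = chain-≈ x
      (λ i → ≈-trans (*-congˡ-≈ (pos 1 / b i) (x≋z i)) (≗⇒≈ λ _ → sym (trans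
        (levels-inject₁ (snoc z (pos k)) i)
        (cong (λ w → (pos 1 / b i) * (w / 1)) (snoc-inject₁ z (pos k) i)))))
      (≗⇒≈ λ _ → sym (trans (levels-fromℕ (snoc z (pos k))) (cong (_/ 1) (snoc-fromℕ z (pos k)))))

    -- An explicit left inverse of `φ` in degree k. It yields injectivity, and it carries
    -- non-negativity of a path over to its image.
    Δ-chain-φ : ∀ {a} → seq (deg a) ≈ seq (fromℤ (pos k)) →
                ∀ i → (λ m → Δ (coords (chain (φ b a)) m) i) ≈ seq (a i)
    Δ-chain-φ {a} deg≈k i = ≈-trans
      (Δ-cong-≈ {α = coords (chain (φ b a))} {β = λ m → prefix (coords a m)} (chain-φ {a} deg≈k) i)
      (≗⇒≈ λ m → Δ-prefix (coords a m) i)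

    φ-injective : ∀ {a a′} → seq (deg a) ≈ seq (fromℤ (pos k)) → seq (deg a′) ≈ seq (fromℤ (pos k)) →
                  φ b a ≋ˢ φ b a′ → a ≋ˢ a′
    φ-injective {a} {a′} deg≈k deg′≈k φa≋φa′ i = ≈-trans (≈-sym (Δ-chain-φ {a} deg≈k i)) (≈-trans
      (Δ-cong-≈ {α = coords (chain (φ b a))} {β = coords (chain (φ b a′))}
        (chain-cong {φ b a} {φ b a′} φa≋φa′) i)
      (Δ-chain-φ {a′} deg′≈k i))

-- The dilated polytope as a monotonicity condition, and the two directions of the bijection.

module _ {m : ℕ} (b : Vector ℕ (suc m)) .{{_ : ∀ {i} → NonZero (b i)}} (k : ℕ) where

  chain-inject₁≡÷ : ∀ x i → chain b k x (inject₁ i) ≡ x i ÷ b i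
  chain-inject₁≡÷ x i = trans (chain-inject₁ b k x i) (scale≡÷ b x i)

  -- At index zero `Δ` is x₁/b₁ itself, which gives the lower bound 0; the last index gives the
  -- upper bound k.
  Increasing : ℝ^ (suc m) → Set
  Increasing x = ∀ i → seq 0ℝ ≲ (λ l → Δ (coords (chain b k x) l) i)

  polytope⇒increasing : ∀ {x} → (k ·P⟨ b ⟩) x → Increasing x
  polytope⇒increasing {x} (0≤x₀ , x≤x , x≤k) zero =
    subst (λ y → seq 0ℝ ≲ seq y) (sym (chain-inject₁≡÷ x zero)) (≲-intro 0≤x₀)
  polytope⇒increasing {x} (0≤x₀ , x≤x , x≤k) (suc i) = s≲t⇒0≲t-s (step i)
    where
      step : ∀ i → seq (chain b k x (inject₁ i)) ≲ seq (chain b k x (suc i))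
      step = last-induction (λ i → seq (chain b k x (inject₁ i)) ≲ seq (chain b k x (suc i)))
        (λ i → subst₂ (λ x y → seq x ≲ seq y) (sym (chain-inject₁≡÷ x (inject₁ i)))
                      (sym (chain-inject₁≡÷ x (suc i))) (≲-intro (x≤x i)))
        -- `suc (fromℕ m)` is the last index of the chain, whose entry is k.
        (subst₂ (λ x y → seq x ≲ seq y) (sym (chain-inject₁≡÷ x (fromℕ m)))
                (sym (chain-fromℕ b k x)) (≲-intro x≤k))

  increasing⇒polytope : ∀ {x} → Increasing x → (k ·P⟨ b ⟩) x
  increasing⇒polytope {x} inc =
    subst (0ℝ ≤ℝ_) (chain-inject₁≡÷ x zero) (≲⇒≤ℝ 0ℝ (chain b k x zero) (inc zero)) ,
    (λ i → subst₂ _≤ℝ_ (chain-inject₁≡÷ x (inject₁ i)) (chain-inject₁≡÷ x (suc i)) (step (inject₁ i))) ,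
    subst₂ _≤ℝ_ (chain-inject₁≡÷ x (fromℕ m)) (chain-fromℕ b k x) (step (fromℕ m))
    where
      step : ∀ i → chain b k x (inject₁ i) ≤ℝ chain b k x (suc i)
      step i = ≲⇒≤ℝ (chain b k x (inject₁ i)) (chain b k x (suc i)) (0≲t-s⇒s≲t (inc (suc i)))

  φ-maps : ∀ a → Π-of-degree b k a → (k ·P⟨ b ⟩ ∩ ℤ^ (suc m)) (φ b a)
  φ-maps a ((a∈L , a≥0) , deg≈k) =
    let (c , a≋) = Lattice⇒combination (v b) {a} a∈L
    in increasing⇒polytope {φ b a} (λ i →
         ≲-trans (≤ℝ⇒≲ 0ℝ (a i) (a≥0 i))
           (≈⇒≲ (≈-sym (Δ-chain-φ b k {a} (≈ℝ⇒≈ (deg a) (fromℤ (pos k)) deg≈k) i)))) ,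
       -- The integral coordinates are the coefficients of all generators but the last; the last one
       -- records the degree.
       (c ∘ inject₁ , λ i → ≈⇒≈ℝ (φ b a i) (fromℤ (c (inject₁ i))) (φ-latticePoint b {a} {c} a≋ i))

  φ-surjective : ∀ x → (k ·P⟨ b ⟩ ∩ ℤ^ (suc m)) x → ∃[ a ] (Π-of-degree b k a × φ b a ≋ˢ x)
  φ-surjective x (x∈kP , z , x≋z) =
    a , ((combination∈Lattice (v b) c , λ i → ≲⇒≤ℝ 0ℝ (a i) (a≥0 i)) , ≈⇒≈ℝ (deg a) (fromℤ (pos k)) deg≈k) , λ i →
      ≈-trans (φ-latticePoint b {a} {c} (λ _ → ≈-refl) i)
        (≈-trans (≗⇒≈ λ l → cong (λ w → seq (fromℤ w) l) (snoc-inject₁ z (pos k) i))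
          (≈-sym (≈ℝ⇒≈ (x i) (fromℤ (z i)) (x≋z i))))
    where
      -- By `φ-latticePoint` the first coefficients become the image, and by `deg-latticePoint` the
      -- last one becomes the degree.
      c = snoc z (pos k)
      a = latticePoint b c
      a≥0 : ∀ i → seq 0ℝ ≲ seq (a i)
      -- The coordinates of `a` and the consecutive differences of the chain of `x` are both the
      -- differences of `levels b c`.
      a≥0 i = ≲-trans (polytope⇒increasing {x} x∈kP i) (≈⇒≲ (≈-trans
        (Δ-cong-≈ {α = coords (chain b k x)} {β = λ _ → levels b c}
          (chain-levels b k {x} {z} (λ i → ≈ℝ⇒≈ (x i) (fromℤ (z i)) (x≋z i))) i)
        (≗⇒≈ λ l → sym (coords-latticePoint b c l i))))
      deg≈k : seq (deg a) ≈ seq (fromℤ (pos k))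
      deg≈k = ≈-trans (deg-latticePoint b {a} {c} (λ _ → ≈-refl))
        (≗⇒≈ λ l → cong (λ w → seq (fromℤ w) l) (snoc-fromℕ z (pos k)))

-- Assembling the bijection.

≋-isEquivalence : IsEquivalence (_≋_ {n})
≋-isEquivalence = record
  { refl  = λ {x} i → ≈⇒≈ℝ (x i) (x i) ≈-refl
  ; sym   = λ {x} {y} x≋y i → ≈⇒≈ℝ (y i) (x i) (≈-sym (≈ℝ⇒≈ (x i) (y i) (x≋y i)))
  ; trans = λ {x} {y} {z} x≋y y≋z i → ≈⇒≈ℝ (x i) (z i)
      (≈-trans (≈ℝ⇒≈ (x i) (y i) (x≋y i)) (≈ℝ⇒≈ (y i) (z i) (y≋z i)))
  }

proposition2p5 : ∀ (m : ℕ) → let n = suc m in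
    (b : Vector ℕ n) .{{_ : ∀ {i} → NonZero (b i)}} (k : ℕ) →
    RestrictsToBijection (φ b) (Π-of-degree b k) (k ·P⟨ b ⟩ ∩ ℤ^ n)
proposition2p5 m b k = φ-maps b k , record
  { isInjection = record
    { isCongruent = record
      { cong           = λ {(a , _)} {(a′ , _)} a≋a′ i →
                           ≈⇒≈ℝ (φ b a i) (φ b a′ i) (φ-cong b {a} {a′} (λ j → ≈ℝ⇒≈ (a j) (a′ j) (a≋a′ j)) i)
      ; isEquivalence₁ = On.isEquivalence proj₁ ≋-isEquivalence
      ; isEquivalence₂ = On.isEquivalence proj₁ ≋-isEquivalence
      }
    ; injective = λ {(a , _ , deg≈k)} {(a′ , _ , deg′≈k)} φa≋φa′ i →
        ≈⇒≈ℝ (a i) (a′ i) (φ-injective b k {a} {a′}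
          (≈ℝ⇒≈ (deg a) (fromℤ (pos k)) deg≈k) (≈ℝ⇒≈ (deg a′) (fromℤ (pos k)) deg′≈k)
          (λ j → ≈ℝ⇒≈ (φ b a j) (φ b a′ j) (φa≋φa′ j)) i)
    }
  ; surjective = λ (x , x∈B) →
      let (a , a∈A , φa≋x) = φ-surjective b k x x∈B
      -- Surjectivity between setoids asks that everything equal to the preimage map to `x`, hence
      -- the appeal to `φ-cong`.
      in (a , a∈A) , λ {(a′ , _)} a′≋a i →
           ≈⇒≈ℝ (φ b a′ i) (x i)
             (≈-trans (φ-cong b {a′} {a} (λ j → ≈ℝ⇒≈ (a′ j) (a j) (a′≋a j)) i) (φa≋x i))
  }
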